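{- Let $n\ge 6$ be an integer and let $m^*=\lfloor (n-1)/4\rfloor$. Then the sequence $\{A(n,m)\}_{m=0}^{n-2}$ is strongly unimodal with mode $m^*$, that is, \[ A(n,0)<A(n,1)<\dots<A(n,m^*)>A(n,m^*+1)>A(n,m^*+2)>\dots>A(n,n-2). \]
   Context: For $n\ge 1$, let $\mathcal H_n$ be the set of integer partitions $\lambda=\lambda_1\lambda_2\cdots$ (written with positive parts in weakly decreasing order) whose largest hook length is $n$; equivalently, $\lambda_1+\ell(\lambda)-1=n$, where $\ell(\lambda)$ is the number of parts. $A(n,m)$ denotes the number of partitions in $\mathcal H_n$ with exactly $m$ even parts (counted with multiplicity). Equivalently (a known fact recalled in the paper), $A(n,m)=\sum_{k}\binom{k}{m}\binom{n-1-k}{k-m}$, where $\binom{a}{b}=0$ unless $0\le b\le a$; these numbers satisfy $A(n,m)=A(n-1,m)+A(n-1,m-1)+A(n-2,m)-A(n-2,m-1)$ for $n\ge 2$, with $A(0,0)=0$ and $A(1,0)=1$ (all other values $A(0,m)$ and $A(1,m)$ being $0$). -}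

module Defs where

open import Data.List using (List; []; _∷_; _++_; length; map; filter; upTo; cartesianProductWith)
open import Data.List.Properties using (filter-all; ∷-injective)
open import Data.List.Membership.Propositional using (_∈_)
open import Data.List.Membership.Propositional.Properties
  using (∈-cartesianProductWith⁺; ∈-cartesianProductWith⁻; ∈-filter⁺; ∈-filter⁻; ∈-upTo⁺)
open import Data.List.Relation.Unary.All as All using (All; []; _∷_; all?)
open import Data.List.Relation.Unary.Any using (here; there; any?)
open import Data.List.Relation.Unary.AllPairs using ([]; _∷_)
open import Data.List.Relation.Unary.Linked using (Linked; linked?)
open import Data.List.Relation.Unary.Linked.Properties using (Linked⇒All)
open import Data.List.Relation.Unary.Unique.Propositional using (Unique)
import Data.List.Relation.Unary.Unique.Propositional.Properties as Unique
open import Data.Nat using (ℕ; zero; suc; _+_; _∸_; _≤_; _<_; _≥_; _>_; z≤n; s≤s; _≟_; _≤?_; _≥?_; _>?_)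
open import Data.Nat.Divisibility using (_∣_; _∣?_)
open import Data.Nat.Properties using (≤-trans; ≤-refl; ≤-reflexive; m≤m+n; m≤n+m; +-suc; +-comm)
open import Data.Product using (_×_; _,_; proj₂)
open import Function using (_⇔_; mk⇔)
open import Relation.Binary.PropositionalEquality using (_≡_; _≢_; refl; sym; trans; cong)
open import Relation.Nullary using (Dec; _×-dec_)
open import Relation.Nullary.Decidable using (map′)

record IsPartition (ps : List ℕ) : Set where
  constructor isPartition
  field
    decreasing : Linked _≥_ ps
    positive   : All (_> 0) ps

-- `parts≥ j ps` is the length of the j-th column of the Young diagram
-- whose rows are `ps`.
parts≥ : ℕ → List ℕ → ℕ
parts≥ j ps = length (filter (_≥? j) ps)

-- The hook lengths (arm + leg + 1) of the cells in a row of length `p`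
-- lying directly above the rows `ps`.  Columns are indexed from 0 by `j`.
rowHookLengths : ℕ → List ℕ → List ℕ
rowHookLengths p ps =
  map (λ j → (p ∸ suc j) + parts≥ (suc j) ps + 1) (upTo p)

hookLengths : List ℕ → List ℕ
hookLengths []       = []
hookLengths (p ∷ ps) = rowHookLengths p ps ++ hookLengths ps

IsMaximum : ℕ → List ℕ → Set
IsMaximum n xs = n ∈ xs × All (_≤ n) xs

record InH (n : ℕ) (ps : List ℕ) : Set where
  constructor inH
  field
    partition   : IsPartition ps
    largestHook : IsMaximum n (hookLengths ps)

isPartition? : ∀ ps → Dec (IsPartition ps)
isPartition? ps = map′ (λ (d , p) → isPartition d p) (λ (isPartition d p) → d , p)
  (linked? _≥?_ ps ×-dec all? (_>? 0) ps)

inH? : ∀ n ps → Dec (InH n ps)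
inH? n ps = map′ (λ (p , h) → inH p h) (λ (inH p h) → p , h)
  (isPartition? ps ×-dec (any? (n ≟_) (hookLengths ps) ×-dec all? (_≤? n) (hookLengths ps)))

-- All lists of length at most `k` with entries at most `b`.
boundedLists : ℕ → ℕ → List (List ℕ)
boundedLists b zero    = [] ∷ []
boundedLists b (suc k) = [] ∷ cartesianProductWith _∷_ (upTo (suc b)) (boundedLists b k)

-- Enumerates InH n without omission or repetition, see `∈H⇔InH` and
-- `H-unique` below.
H : ℕ → List (List ℕ)
H n = filter (inH? n) (boundedLists n n)

evenParts : List ℕ → ℕ
evenParts ps = length (filter (2 ∣?_) ps)

A : ℕ → ℕ → ℕ
A n m = length (filter (λ ps → evenParts ps ≟ m) (H n))

-- The finite sequence f 0, …, f N increases strictly up to index k and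
-- decreases strictly from there on.
record StronglyUnimodal (f : ℕ → ℕ) (N k : ℕ) : Set where
  constructor stronglyUnimodal
  field
    mode≤N     : k ≤ N
    increasing : ∀ i → i < k → f i < f (suc i)
    decreasing : ∀ i → k ≤ i → i < N → f i > f (suc i)

∈-boundedLists : ∀ {b} k {ps} → length ps ≤ k → All (_≤ b) ps → ps ∈ boundedLists b k
∈-boundedLists zero    {[]}    _         _          = here refl
∈-boundedLists (suc k) {[]}    _         _          = here refl
∈-boundedLists (suc k) {_ ∷ _} (s≤s len) (p≤b ∷ ps≤b) =
  there (∈-cartesianProductWith⁺ _∷_ (∈-upTo⁺ (s≤s p≤b)) (∈-boundedLists k len ps≤b))

boundedLists-unique : ∀ b k → Unique (boundedLists b k)
boundedLists-unique b zero    = [] ∷ []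
boundedLists-unique b (suc k) =
  All.tabulate []∉ ∷
  Unique.cartesianProductWith⁺ _∷_ ∷-injective (Unique.upTo⁺ (suc b)) (boundedLists-unique b k)
  where
  []∉ : ∀ {ps} → ps ∈ cartesianProductWith _∷_ (upTo (suc b)) (boundedLists b k) → [] ≢ ps
  []∉ ps∈ refl with ∈-cartesianProductWith⁻ _∷_ (upTo (suc b)) (boundedLists b k) ps∈
  ... | _ , _ , _ , _ , ()

InH⇒bounded : ∀ {n ps} → InH n ps → length ps ≤ n × All (_≤ n) ps
InH⇒bounded {ps = []} _ = z≤n , []
InH⇒bounded {n} {suc p ∷ ps} (inH (isPartition dec (_ ∷ pos)) (_ , hook≤n ∷ _)) =
    ≤-trans (≤-trans (m≤n+m _ p) (≤-reflexive eq)) hook≤n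
  , All.map (λ q≤p → ≤-trans q≤p p≤n) (Linked⇒All (λ x≥y y≥z → ≤-trans y≥z x≥y) ≤-refl dec)
  where
  eq : p + suc (length ps) ≡ p + parts≥ 1 ps + 1
  eq = trans (+-suc p _) (trans (cong (λ qs → suc (p + length qs)) (sym (filter-all (_≥? 1) pos)))
         (sym (+-comm _ 1)))
  p≤n : suc p ≤ n
  p≤n = ≤-trans (s≤s (m≤m+n p _)) (≤-trans (≤-reflexive (+-comm 1 _)) hook≤n)

∈H⇔InH : ∀ n ps → ps ∈ H n ⇔ InH n ps
∈H⇔InH n ps = mk⇔
  (λ ps∈H → proj₂ (∈-filter⁻ (inH? n) {xs = boundedLists n n} ps∈H))
  (λ h → let len , bnd = InH⇒bounded h in ∈-filter⁺ (inH? n) (∈-boundedLists n len bnd) h)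

H-unique : ∀ n → Unique (H n)
H-unique n = Unique.filter⁺ (inH? n) (boundedLists-unique n n)

{-# OPTIONS --safe #-}

-- Partitions with largest hook n + 1 arise, each exactly once, from those with largest hook n by repeating
-- the largest part or increasing it by 1. Sorting by the parity of the largest part turns this into a
-- Pascal-like recurrence. In a fixed column m ≥ 1, let c w be the number of partitions with largest hook
-- n = m + w, odd largest part and m even parts. Its generating function is a product of powers of x, 1 − x
-- and 1 − x − x², hence satisfies a first-order differential equation, which amounts to
--   w (c (w + 3) − 2 c (w + 2)) = 2 m c (w + 1) − n c w,
-- while A n (m − 1) − A n m = c (w + 3) − 2 c (w + 2). If c (w + 1) > 2 c w and n ≤ 4 m, then the right
-- hand side is positive; if c (w + 1) < 2 c w and n ≥ 4 m, then it is negative. So the sign propagates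
-- from w to w + 2 on each side of n = 4 m. What remains is the start of the second range, n = 4 m + 1 and
-- n = 4 m + 2, where c (w + 1) / c w may exceed 2 but has to be less than n / (2 m); see ratio-bound.

module Submission where

open import Defs
open import Data.Bool using (true; false)
open import Data.Empty using (⊥-elim)
import Data.Integer.Base as Int
open import Data.Integer.Base using (ℤ)
import Data.Integer.Properties as ℤ
open import Data.Integer.Solver using (module +-*-Solver)
import Data.Integer.Tactic.RingSolver as ℤRing
open import Data.List using (List; []; _∷_; _++_; length; map; filter)
open import Data.List.Properties
  using (length-++; filter-++; filter-≐; filter-none; filter-accept; filter-reject; filter-all; length-filter)
open import Data.List.Membership.Propositional using (_∈_)
open import Data.List.Membership.Propositional.Properties using (∈-map⁺; ∈-map⁻; ∈-++⁺ˡ; ∈-++⁺ʳ)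
open import Data.List.Membership.Propositional.Properties.WithK using (unique∧set⇒bag)
open import Data.List.Relation.Binary.BagAndSetEquality using (∼bag⇒↭)
open import Data.List.Relation.Binary.Disjoint.Propositional using (Disjoint)
open import Data.List.Relation.Binary.Permutation.Propositional using (_↭_)
open import Data.List.Relation.Binary.Permutation.Propositional.Properties using (filter-↭; ↭-length)
open import Data.List.Relation.Unary.All as All using (All; []; _∷_)
import Data.List.Relation.Unary.All.Properties as All
open import Data.List.Relation.Unary.AllPairs using ([]; _∷_)
open import Data.List.Relation.Unary.Any using (here)
open import Data.List.Relation.Unary.Linked using (Linked; [-]; _∷_)
open import Data.List.Relation.Unary.Unique.Propositional using (Unique)
import Data.List.Relation.Unary.Unique.Propositional.Properties as Unique
open import Data.Nat
  using (ℕ; zero; suc; _+_; _*_; _∸_; _/_; _%_; _≤_; _<_; _≥_; z≤n; s≤s; s≤s⁻¹; _≤?_; _≟_; _≥?_; NonZero; >-nonZero)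
open import Data.Nat.Divisibility using (_∣_; _∣?_; _∣0; ∣-refl; ∣1⇒≡1; ∣m∣n⇒∣m+n; ∣m+n∣m⇒∣n)
open import Data.Nat.DivMod using (m/n<m; m/n*n≤m; m%n<n; m≡m%n+[m/n]*n; /-monoˡ-≤)
open import Data.Nat.Properties
open import Data.Nat.Tactic.RingSolver using (solve-∀)
open import Data.Product using (_×_; _,_; proj₁; uncurry)
open import Data.Sum using (_⊎_; inj₁; inj₂)
open import Function using (_∘_; _⇔_; mk⇔; Equivalence)
open import Level using (Level)
open import Relation.Binary.PropositionalEquality
open import Relation.Nullary using (¬_; yes; no; does; ¬?; _×-dec_)
open import Relation.Unary using (Pred; Decidable)

private
  variable
    ℓ : Level
    B C : Set
    P Q : Pred B ℓ

-- Generating the partitions with a given largest hook.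

Shape : Set
Shape = ℕ × List ℕ

⟦_⟧ : Shape → List ℕ
⟦_⟧ = uncurry _∷_

dup inc : Shape → Shape
dup (p , ps) = p , p ∷ ps
inc (p , ps) = suc p , ps

shapes : ℕ → List Shape
shapes zero    = (1 , []) ∷ []
shapes (suc k) = map dup (shapes k) ++ map inc (shapes k)

-- `p + length ps` is the hook length of the corner cell, because the head is not counted in `ps`.
-- `InH⇔HasHook` identifies it with the largest hook.
HasHook : ℕ → Shape → Set
HasHook n (p , ps) = IsPartition (p ∷ ps) × p + length ps ≡ n

shapes-sound : ∀ k → All (HasHook (suc k)) (shapes k)
shapes-sound zero    = (isPartition [-] (s≤s z≤n ∷ []) , refl) ∷ []
shapes-sound (suc k) = All.++⁺ (All.map⁺ (All.map dup-hook (shapes-sound k)))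
                               (All.map⁺ (All.map inc-hook (shapes-sound k)))
  where
  dup-hook : ∀ {x} → HasHook (suc k) x → HasHook (2 + k) (dup x)
  dup-hook {p , ps} (isPartition dec pos@(p>0 ∷ _) , eq) =
    isPartition (≤-refl ∷ dec) (p>0 ∷ pos) , trans (+-suc p (length ps)) (cong suc eq)
  inc-hook : ∀ {x} → HasHook (suc k) x → HasHook (2 + k) (inc x)
  inc-hook {p , ps} (isPartition dec (_ ∷ pos) , eq) =
    isPartition (raise dec) (s≤s z≤n ∷ pos) , cong suc eq
    where
    raise : ∀ {qs} → Linked _≥_ (p ∷ qs) → Linked _≥_ (suc p ∷ qs)
    raise [-]         = [-]
    raise (p≥q ∷ dec) = m≤n⇒m≤1+n p≥q ∷ dec

-- The two largest parts determine the last move: if they agree it was `dup`; if they differ, or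
-- there is only one part, it was `inc`. Undoing that move lowers the hook by 1.
shapes-complete : ∀ k {x} → HasHook (suc k) x → x ∈ shapes k
shapes-complete zero {suc zero , []}    _ = here refl
shapes-complete zero {suc p , _ ∷ ps}   (_ , eq) with () ← trans (sym (+-suc p (length ps))) (suc-injective eq)
shapes-complete zero {zero , _}         (isPartition _ (() ∷ _) , _)
shapes-complete (suc k) {p , []} (isPartition _ _ , eq) with refl ← trans (sym eq) (+-identityʳ p) =
  ∈-++⁺ʳ _ (∈-map⁺ inc (shapes-complete k (isPartition [-] (s≤s z≤n ∷ []) , +-identityʳ (suc k))))
shapes-complete (suc k) {zero , _ ∷ _} (isPartition _ (() ∷ _) , _)
shapes-complete (suc k) {suc p , q ∷ qs} (isPartition (q≤p ∷ dec) (_ ∷ pos@(q>0 ∷ _)) , eq) with suc p ≟ q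
... | yes refl = ∈-++⁺ˡ (∈-map⁺ dup (shapes-complete k
                   (isPartition dec pos , suc-injective (trans (sym (+-suc (suc p) (length qs))) eq))))
... | no p≢q   = ∈-++⁺ʳ _ (∈-map⁺ inc (shapes-complete k
                   (isPartition (q≤p′ ∷ dec) (≤-trans q>0 q≤p′ ∷ pos) , suc-injective eq)))
  where q≤p′ = s≤s⁻¹ (≤∧≢⇒< q≤p (p≢q ∘ sym))

shapes-unique : ∀ k → Unique (shapes k)
shapes-unique zero    = [] ∷ []
shapes-unique (suc k) = Unique.++⁺ (Unique.map⁺ (λ {refl → refl}) (shapes-unique k))
                                   (Unique.map⁺ (λ {refl → refl}) (shapes-unique k)) disjoint
  where
  disjoint : Disjoint (map dup (shapes k)) (map inc (shapes k))
  disjoint (x∈dup , x∈inc) with ∈-map⁻ dup x∈dup | ∈-map⁻ inc x∈inc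
  ... | _ , _ , refl | (q , _) , y∈ , refl with All.lookup (shapes-sound k) y∈
  ...   | isPartition (q≥1+q ∷ _) _ , _ = 1+n≰n q≥1+q

-- The largest hook sits in the corner.

first-hook : ∀ p {ps} → All (λ q → 0 < q) ps → p + parts≥ 1 ps + 1 ≡ suc p + length ps
first-hook p {ps} pos = trans (+-comm _ 1) (cong (λ qs → suc (p + length qs)) (filter-all (_≥? 1) pos))

hooks-bounded : ∀ {p ps} → IsPartition (p ∷ ps) → All (_≤ p + length ps) (hookLengths (p ∷ ps))
hooks-bounded {p} {ps} (isPartition dec (_ ∷ pos)) =
  All.++⁺ (All.map⁺ (All.map (row p) (All.all-upTo p))) (rest dec pos)
  where
  row : ∀ p {j} → j < p → (p ∸ suc j) + parts≥ (suc j) ps + 1 ≤ p + length ps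
  row (suc p) {j} _ = ≤-trans (≤-reflexive (+-comm _ 1))
    (s≤s (+-mono-≤ (m∸n≤m p j) (length-filter (_≥? suc j) ps)))
  rest : ∀ {ps} → Linked _≥_ (p ∷ ps) → All (λ q → 0 < q) ps → All (_≤ p + length ps) (hookLengths ps)
  rest {[]}     _           _   = []
  rest {q ∷ qs} (p≥q ∷ dec) pos =
    All.map (λ h → ≤-trans h (+-mono-≤ p≥q (n≤1+n _))) (hooks-bounded (isPartition dec pos))

InH⇔HasHook : ∀ n p ps → InH n (p ∷ ps) ⇔ HasHook n (p , ps)
InH⇔HasHook n zero ps = mk⇔ (λ {(inH (isPartition _ (() ∷ _)) _)}) (λ {(isPartition _ (() ∷ _) , _)})
InH⇔HasHook n (suc p) ps = mk⇔ to from
  where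
  to : InH n (suc p ∷ ps) → HasHook n (suc p , ps)
  to (inH part@(isPartition _ (_ ∷ pos)) (n∈ , hook≤n ∷ _)) =
    part , ≤-antisym (≤-trans (≤-reflexive (sym (first-hook p pos))) hook≤n) (All.lookup (hooks-bounded part) n∈)
  from : HasHook n (suc p , ps) → InH n (suc p ∷ ps)
  from (part@(isPartition _ (_ ∷ pos)) , refl) = inH part (here (sym (first-hook p pos)) , hooks-bounded part)

-- Both lists are free of repetitions and have the same members, so they agree as bags.
H↭shapes : ∀ k → H (suc k) ↭ map ⟦_⟧ (shapes k)
H↭shapes k = ∼bag⇒↭ (unique∧set⇒bag (H-unique (suc k))
  (Unique.map⁺ (λ {refl → refl}) (shapes-unique k)) (mk⇔ (to _) from))
  where
  to : ∀ ps → ps ∈ H (suc k) → ps ∈ map ⟦_⟧ (shapes k)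
  to ps ps∈ with ps | Equivalence.to (∈H⇔InH (suc k) ps) ps∈
  ... | []     | inH _ (() , _)
  ... | p ∷ qs | h = ∈-map⁺ ⟦_⟧ (shapes-complete k (Equivalence.to (InH⇔HasHook (suc k) p qs) h))
  from : ∀ {ps} → ps ∈ map ⟦_⟧ (shapes k) → ps ∈ H (suc k)
  from ps∈ with (p , qs) , x∈ , refl ← ∈-map⁻ ⟦_⟧ ps∈ =
    Equivalence.from (∈H⇔InH (suc k) (p ∷ qs)) (Equivalence.from (InH⇔HasHook (suc k) p qs) (All.lookup (shapes-sound k) x∈))

-- Counting by the parity of the largest part.

count : {P : Pred B ℓ} → Decidable P → List B → ℕ
count P? xs = length (filter P? xs)

count-++ : (P? : Decidable P) → ∀ xs ys → count P? (xs ++ ys) ≡ count P? xs + count P? ys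
count-++ P? xs ys = trans (cong length (filter-++ P? xs ys)) (length-++ (filter P? xs))

count-map : (P? : Decidable P) (f : C → B) → ∀ xs → count P? (map f xs) ≡ count (P? ∘ f) xs
count-map P? f []       = refl
count-map P? f (x ∷ xs) with does (P? (f x))
... | true  = cong suc (count-map P? f xs)
... | false = count-map P? f xs

count-split : (P? : Decidable P) (Q? : Decidable Q) → ∀ xs →
  count P? xs ≡ count (λ x → P? x ×-dec ¬? (Q? x)) xs + count (λ x → P? x ×-dec Q? x) xs
count-split P? Q? []       = refl
count-split P? Q? (x ∷ xs) with does (P? x) | does (Q? x)
... | false | _     = count-split P? Q? xs
... | true  | false = cong suc (count-split P? Q? xs)
... | true  | true  = trans (cong suc (count-split P? Q? xs)) (sym (+-suc _ _))

evenParts-even : ∀ {p} ps → 2 ∣ p → evenParts (p ∷ ps) ≡ suc (evenParts ps)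
evenParts-even ps 2∣p = cong length (filter-accept (2 ∣?_) 2∣p)

evenParts-odd : ∀ {p} ps → ¬ 2 ∣ p → evenParts (p ∷ ps) ≡ evenParts ps
evenParts-odd ps 2∤p = cong length (filter-reject (2 ∣?_) 2∤p)

2∣n⊎2∣1+n : ∀ n → 2 ∣ n ⊎ 2 ∣ suc n
2∣n⊎2∣1+n zero    = inj₁ (2 ∣0)
2∣n⊎2∣1+n (suc n) with 2∣n⊎2∣1+n n
... | inj₁ 2∣n   = inj₂ (∣m∣n⇒∣m+n ∣-refl 2∣n)
... | inj₂ 2∣1+n = inj₁ 2∣1+n

2∤n⇒2∣1+n : ∀ {n} → ¬ 2 ∣ n → 2 ∣ suc n
2∤n⇒2∣1+n {n} 2∤n with 2∣n⊎2∣1+n n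
... | inj₁ 2∣n   = ⊥-elim (2∤n 2∣n)
... | inj₂ 2∣1+n = 2∣1+n

2∣n⇒2∤1+n : ∀ {n} → 2 ∣ n → ¬ 2 ∣ suc n
2∣n⇒2∤1+n {n} 2∣n 2∣1+n with () ← ∣1⇒≡1 (∣m+n∣m⇒∣n (subst (2 ∣_) (+-comm 1 n) 2∣1+n) 2∣n)

total? : ∀ m → Decidable (λ (x : Shape) → evenParts ⟦ x ⟧ ≡ m)
total? m x = evenParts ⟦ x ⟧ ≟ m

headEven? : Decidable (λ (x : Shape) → 2 ∣ proj₁ x)
headEven? x = 2 ∣? proj₁ x

OddHead EvenHead : ℕ → Pred Shape _
OddHead  m x = evenParts ⟦ x ⟧ ≡ m × ¬ 2 ∣ proj₁ x
EvenHead m x = evenParts ⟦ x ⟧ ≡ m × 2 ∣ proj₁ x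

oddHead? : ∀ m → Decidable (OddHead m)
oddHead? m x = total? m x ×-dec ¬? (headEven? x)

evenHead? : ∀ m → Decidable (EvenHead m)
evenHead? m x = total? m x ×-dec headEven? x

no-evenHead-0 : ∀ k → count (evenHead? 0) (shapes k) ≡ 0
no-evenHead-0 k = cong length (filter-none (evenHead? 0) (All.universal none (shapes k)))
  where
  none : ∀ x → ¬ EvenHead 0 x
  none (p , ps) (eq , 2∣p) with () ← trans (sym (evenParts-even ps 2∣p)) eq

count-≐ : (P? : Decidable P) (Q? : Decidable Q) → (∀ {x} → P x → Q x) → (∀ {x} → Q x → P x) →
  ∀ xs → count P? xs ≡ count Q? xs
count-≐ P? Q? P⊆Q Q⊆P xs = cong length (filter-≐ P? Q? (P⊆Q , Q⊆P) xs)

count-shapes : ∀ (P? : Decidable P) k →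
  count P? (shapes (suc k)) ≡ count (P? ∘ dup) (shapes k) + count (P? ∘ inc) (shapes k)
count-shapes P? k = trans (count-++ P? (map dup (shapes k)) (map inc (shapes k)))
  (cong₂ _+_ (count-map P? dup (shapes k)) (count-map P? inc (shapes k)))

-- Number of partitions with largest hook k + 1 and odd (resp. even) largest part. The column index m is
-- the number of even parts for oddHeaded, but one less than the number of even parts for evenHeaded.
mutual
  oddHeaded : ℕ → ℕ → ℕ
  oddHeaded zero    zero    = 1
  oddHeaded zero    (suc _) = 0
  oddHeaded (suc k) m       = oddHeaded k m + evenHeaded k m

  evenHeaded : ℕ → ℕ → ℕ
  evenHeaded zero    _       = 0
  evenHeaded (suc k) zero    = oddHeaded k 0
  evenHeaded (suc k) (suc m) = evenHeaded k m + oddHeaded k (suc m)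

mutual
  -- An odd head after `dup` was odd before, and repeating it adds no even part. An odd head after
  -- `inc` was even before, so one even part is lost; the shifted column index of `evenHeaded`
  -- absorbs this.
  count-oddHeaded : ∀ k m → count (oddHead? m) (shapes k) ≡ oddHeaded k m
  count-oddHeaded zero    zero    = refl
  count-oddHeaded zero    (suc m) = refl
  count-oddHeaded (suc k) m       = trans (count-shapes (oddHead? m) k) (cong₂ _+_
    (trans (count-≐ (oddHead? m ∘ dup) (oddHead? m) dup⇒ dup⇐ (shapes k)) (count-oddHeaded k m))
    (trans (count-≐ (oddHead? m ∘ inc) (evenHead? (suc m)) inc⇒ inc⇐ (shapes k)) (count-evenHeaded k m)))
    where
    dup⇒ : ∀ {x} → OddHead m (dup x) → OddHead m x
    dup⇒ {p , ps} (eq , 2∤p) = trans (sym (evenParts-odd (p ∷ ps) 2∤p)) eq , 2∤p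
    dup⇐ : ∀ {x} → OddHead m x → OddHead m (dup x)
    dup⇐ {p , ps} (eq , 2∤p) = trans (evenParts-odd (p ∷ ps) 2∤p) eq , 2∤p
    inc⇒ : ∀ {x} → OddHead m (inc x) → EvenHead (suc m) x
    inc⇒ {p , ps} (eq , 2∤1+p) with 2∣n⊎2∣1+n p
    ... | inj₁ 2∣p   = trans (evenParts-even ps 2∣p) (cong suc (trans (sym (evenParts-odd ps 2∤1+p)) eq)) , 2∣p
    ... | inj₂ 2∣1+p = ⊥-elim (2∤1+p 2∣1+p)
    inc⇐ : ∀ {x} → EvenHead (suc m) x → OddHead m (inc x)
    inc⇐ {p , ps} (eq , 2∣p) = trans (evenParts-odd ps 2∤1+p) (suc-injective (trans (sym (evenParts-even ps 2∣p)) eq)) , 2∤1+p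
      where 2∤1+p = 2∣n⇒2∤1+n 2∣p

  count-evenHeaded : ∀ k m → count (evenHead? (suc m)) (shapes k) ≡ evenHeaded k m
  count-evenHeaded zero    m = cong length (filter-none (evenHead? (suc m)) {xs = shapes 0} ((λ {(_ , 2∣1) → 2∣n⇒2∤1+n (2 ∣0) 2∣1}) ∷ []))
  count-evenHeaded (suc k) m = trans (trans (count-shapes (evenHead? (suc m)) k) (cong₂ _+_
    (count-≐ (evenHead? (suc m) ∘ dup) (evenHead? m) dup⇒ dup⇐ (shapes k))
    (trans (count-≐ (evenHead? (suc m) ∘ inc) (oddHead? m) inc⇒ inc⇐ (shapes k)) (count-oddHeaded k m)))) (finish k m)
    where
    finish : ∀ k m → count (evenHead? m) (shapes k) + oddHeaded k m ≡ evenHeaded (suc k) m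
    finish k zero    = cong (_+ oddHeaded k 0) (no-evenHead-0 k)
    finish k (suc m) = cong (_+ oddHeaded k (suc m)) (count-evenHeaded k m)
    dup⇒ : ∀ {x} → EvenHead (suc m) (dup x) → EvenHead m x
    dup⇒ {p , ps} (eq , 2∣p) = suc-injective (trans (sym (evenParts-even (p ∷ ps) 2∣p)) eq) , 2∣p
    dup⇐ : ∀ {x} → EvenHead m x → EvenHead (suc m) (dup x)
    dup⇐ {p , ps} (eq , 2∣p) = trans (evenParts-even (p ∷ ps) 2∣p) (cong suc eq) , 2∣p
    inc⇒ : ∀ {x} → EvenHead (suc m) (inc x) → OddHead m x
    inc⇒ {p , ps} (eq , 2∣1+p) = trans (evenParts-odd ps 2∤p) (suc-injective (trans (sym (evenParts-even ps 2∣1+p)) eq)) , 2∤p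
      where
      2∤p : ¬ 2 ∣ p
      2∤p 2∣p = 2∣n⇒2∤1+n 2∣p 2∣1+p
    inc⇐ : ∀ {x} → OddHead m x → EvenHead (suc m) (inc x)
    inc⇐ {p , ps} (eq , 2∤p) = trans (evenParts-even ps 2∣1+p) (cong suc (trans (sym (evenParts-odd ps 2∤p)) eq)) , 2∣1+p
      where 2∣1+p = 2∤n⇒2∣1+n 2∤p

-- Every partition has exactly one successor with even largest part: repeat the largest part if it
-- is even, increase it if it is odd. Either way one even part is gained.
A≡evenHeaded : ∀ k m → A (suc k) m ≡ evenHeaded (suc k) m
A≡evenHeaded k m = begin
  count (λ ps → evenParts ps ≟ m) (H (suc k))
    ≡⟨ ↭-length (filter-↭ _ (H↭shapes k)) ⟩
  count (λ ps → evenParts ps ≟ m) (map ⟦_⟧ (shapes k))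
    ≡⟨ count-map (λ ps → evenParts ps ≟ m) ⟦_⟧ (shapes k) ⟩
  count (total? m) (shapes k)
    ≡⟨ count-split (total? m) headEven? (shapes k) ⟩
  count (oddHead? m) (shapes k) + count (evenHead? m) (shapes k)
    ≡⟨ cong (_+ count (evenHead? m) (shapes k)) (count-oddHeaded k m) ⟩
  oddHeaded k m + count (evenHead? m) (shapes k)
    ≡⟨ finish m ⟩
  evenHeaded (suc k) m ∎
  where
  open ≡-Reasoning
  finish : ∀ m → oddHeaded k m + count (evenHead? m) (shapes k) ≡ evenHeaded (suc k) m
  finish zero    = trans (cong (oddHeaded k 0 +_) (no-evenHead-0 k)) (+-identityʳ _)
  finish (suc m) = trans (cong (oddHeaded k (suc m) +_) (count-evenHeaded k m)) (+-comm (oddHeaded k (suc m)) _)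

-- Recurrences between columns and within a column.

column-recurrence : ∀ k m →
  oddHeaded (2 + k) (suc m) + oddHeaded k m ≡ oddHeaded (1 + k) (suc m) + oddHeaded k (suc m) + oddHeaded (1 + k) m
column-recurrence k m = lemma (oddHeaded k (suc m)) (evenHeaded k (suc m)) (evenHeaded k m) (oddHeaded k m)
  where
  lemma : ∀ o e e′ o′ → o + e + (e′ + o) + o′ ≡ o + e + o + (o′ + e′)
  lemma = solve-∀

-- The generating function Y of oddHeaded _ m is, for m ≥ 1, xᵐ⁺² (1 − x)ᵐ⁻¹ / (1 − x − x²)ᵐ⁺¹, and its
-- logarithmic derivative is rational with denominator x (1 − x)(1 − x − x²) = x (1 − 2x + x³). Clearing
-- denominators gives a recurrence for the coefficients of Y; residual is its defect at κ.
module _ where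
  open Int using (+_; _-_) renaming (_+_ to _⊕_; _*_ to _⊗_)

  residual : (κ μ a₀ a₁ a₂ a₃ : ℤ) → ℤ
  residual κ μ a₀ a₁ a₂ a₃ =
    (κ ⊕ + 1 - μ) ⊗ (a₃ - + 2 ⊗ a₂) ⊕ (κ ⊕ + 1) ⊗ a₀ - + 2 ⊗ μ ⊗ a₁

  residualAt : ℕ → ℕ → ℤ
  residualAt m k = residual (+ k) (+ m)
    (+ oddHeaded k m) (+ oddHeaded (1 + k) m) (+ oddHeaded (2 + k) m) (+ oddHeaded (3 + k) m)

  next : (y₀ y₁ z₀ z₁ : ℤ) → ℤ
  next y₀ y₁ z₀ z₁ = y₁ ⊕ y₀ ⊕ z₁ - z₀

  oddHeaded-next : ∀ k m → + oddHeaded (2 + k) (suc m) ≡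
    next (+ oddHeaded k (suc m)) (+ oddHeaded (1 + k) (suc m)) (+ oddHeaded k m) (+ oddHeaded (1 + k) m)
  oddHeaded-next k m = begin
    + a                             ≡⟨ lemma (+ a) (+ b) ⟩
    + a ⊕ + b - + b                 ≡⟨ cong (λ x → + x - + b) (column-recurrence k m) ⟩
    next (+ oddHeaded k (suc m)) (+ oddHeaded (1 + k) (suc m)) (+ b) (+ oddHeaded (1 + k) m) ∎
    where
    open ≡-Reasoning
    a = oddHeaded (2 + k) (suc m)
    b = oddHeaded k m
    lemma : ∀ x y → x ≡ x ⊕ y - y
    lemma = ℤRing.solve-∀

  -- If Z is the generating function of the preceding column, then (1 − x − x²) Y and (1 − x) x Z agree;
  -- the same relation holds between the two residuals, so that they vanish together.
  residual-next : ∀ κ μ {y₀ y₁ y₂ y₃ y₄ y₅ z₀ z₁ z₂ z₃ z₄} →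
    y₂ ≡ next y₀ y₁ z₀ z₁ → y₃ ≡ next y₁ y₂ z₁ z₂ → y₄ ≡ next y₂ y₃ z₂ z₃ → y₅ ≡ next y₃ y₄ z₃ z₄ →
    residual (+ 2 ⊕ κ) (+ 1 ⊕ μ) y₂ y₃ y₄ y₅ ≡
      residual (+ 1 ⊕ κ) (+ 1 ⊕ μ) y₁ y₂ y₃ y₄ ⊕ residual κ (+ 1 ⊕ μ) y₀ y₁ y₂ y₃
      ⊕ residual (+ 1 ⊕ κ) μ z₁ z₂ z₃ z₄ - residual κ μ z₀ z₁ z₂ z₃
  residual-next κ μ {y₀} {y₁} {z₀ = z₀} {z₁} {z₂} {z₃} {z₄} refl refl refl refl =
    solve 9 (λ κ μ y₀ y₁ z₀ z₁ z₂ z₃ z₄ →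
      let y₂ = nextₚ y₀ y₁ z₀ z₁
          y₃ = nextₚ y₁ y₂ z₁ z₂
          y₄ = nextₚ y₂ y₃ z₂ z₃
          y₅ = nextₚ y₃ y₄ z₃ z₄
      in residualₚ (con (+ 2) :+ κ) (con (+ 1) :+ μ) y₂ y₃ y₄ y₅ :=
         residualₚ (con (+ 1) :+ κ) (con (+ 1) :+ μ) y₁ y₂ y₃ y₄ :+ residualₚ κ (con (+ 1) :+ μ) y₀ y₁ y₂ y₃
         :+ residualₚ (con (+ 1) :+ κ) μ z₁ z₂ z₃ z₄ :- residualₚ κ μ z₀ z₁ z₂ z₃) refl
      κ μ y₀ y₁ z₀ z₁ z₂ z₃ z₄
    where
    open +-*-Solver
    nextₚ : ∀ {n} (y₀ y₁ z₀ z₁ : Polynomial n) → Polynomial n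
    nextₚ y₀ y₁ z₀ z₁ = y₁ :+ y₀ :+ z₁ :- z₀
    residualₚ : ∀ {n} (κ μ a₀ a₁ a₂ a₃ : Polynomial n) → Polynomial n
    residualₚ κ μ a₀ a₁ a₂ a₃ =
      (κ :+ con (+ 1) :- μ) :* (a₃ :- con (+ 2) :* a₂) :+ (κ :+ con (+ 1)) :* a₀ :- con (+ 2) :* μ :* a₁

  -- Column 0 satisfies the Fibonacci recurrence, so there `a₃ - 2 a₂ = - a₀`. The other columns
  -- follow by induction with `residual-next`, which looks back two rows and therefore needs rows 0
  -- and 1 as a start.
  residual-zero : ∀ m k → residualAt m k ≡ + 0
  residual-zero zero k = lemma (+ k) (+ oddHeaded k 0) (+ oddHeaded (1 + k) 0)
    where
    lemma : ∀ κ a b → (κ ⊕ + 1 - + 0) ⊗ (b ⊕ a ⊕ b - + 2 ⊗ (b ⊕ a)) ⊕ (κ ⊕ + 1) ⊗ a - + 2 ⊗ + 0 ⊗ b ≡ + 0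
    lemma = ℤRing.solve-∀
  residual-zero (suc zero)                zero = refl
  residual-zero (suc (suc zero))          zero = refl
  -- All four entries lie above the first nonzero entry of the column and compute to 0.
  residual-zero (suc (suc (suc m)))       zero = lemma (+ m)
    where
    lemma : ∀ μ → (+ 0 ⊕ + 1 - (+ 3 ⊕ μ)) ⊗ + 0 ⊕ + 0 - + 2 ⊗ (+ 3 ⊕ μ) ⊗ + 0 ≡ + 0
    lemma = ℤRing.solve-∀
  residual-zero (suc zero)                (suc zero) = refl
  residual-zero (suc (suc zero))          (suc zero) = refl
  residual-zero (suc (suc (suc zero)))    (suc zero) = refl
  residual-zero (suc (suc (suc (suc m)))) (suc zero) = lemma (+ m)
    where
    lemma : ∀ μ → (+ 1 ⊕ + 1 - (+ 4 ⊕ μ)) ⊗ + 0 ⊕ + 0 - + 2 ⊗ (+ 4 ⊕ μ) ⊗ + 0 ≡ + 0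
    lemma = ℤRing.solve-∀
  residual-zero (suc m) (suc (suc k)) = begin
    residualAt (suc m) (2 + k)
      ≡⟨ residual-next (+ k) (+ m) {z₃ = + oddHeaded (3 + k) m} {z₄ = + oddHeaded (4 + k) m}
           (oddHeaded-next k m) (oddHeaded-next (1 + k) m) (oddHeaded-next (2 + k) m) (oddHeaded-next (3 + k) m) ⟩
    residualAt (suc m) (1 + k) ⊕ residualAt (suc m) k ⊕ residualAt m (1 + k) - residualAt m k
      ≡⟨ cong₂ _-_ (cong₂ _⊕_ (cong₂ _⊕_ (residual-zero (suc m) (suc k)) (residual-zero (suc m) k))
                              (residual-zero m (suc k)))
                   (residual-zero m k) ⟩
    + 0 ∎
    where open ≡-Reasoning

-- Where the columns start.

mutual
  evenHeaded-zero : ∀ {k m} → k ≤ m → evenHeaded k m ≡ 0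
  evenHeaded-zero                 z≤n       = refl
  evenHeaded-zero {suc k} {suc m} (s≤s k≤m) =
    cong₂ _+_ (evenHeaded-zero k≤m) (oddHeaded-zero (m≤n⇒m≤1+n (m≤n⇒m≤1+n k≤m)))

  -- With `suc m` even parts and an odd largest part, that part is at least 3 and there are at least
  -- `m + 2` parts, so the hook `k + 1` is at least `m + 4`.
  oddHeaded-zero : ∀ {k m} → k ≤ 2 + m → oddHeaded k (suc m) ≡ 0
  oddHeaded-zero {zero}  _         = refl
  oddHeaded-zero {suc k} (s≤s k≤m) = cong₂ _+_ (oddHeaded-zero (m≤n⇒m≤1+n k≤m)) (evenHeaded-zero k≤m)

-- The partition into `m + 1` twos is counted here.
evenHeaded-positive : ∀ m → 0 < evenHeaded (suc m) m
evenHeaded-positive zero    = s≤s z≤n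
evenHeaded-positive (suc m) = m≤n⇒m≤n+o _ (evenHeaded-positive m)

-- Cross-multiplied comparisons.

*-swap : ∀ a b x → a * (b * x) ≡ b * (a * x)
*-swap = solve-∀

*-rotate : ∀ a b x → a * b * x ≡ b * (a * x)
*-rotate = solve-∀

-- The equation says `w (x - 2 y) = q - p`; it is written without subtraction.
transfer-< : ∀ w {x y p q} → w * x + p ≡ 2 * w * y + q → p < q → 2 * y < x
transfer-< w {x} {y} {p} {q} eq p<q = *-cancelˡ-< w (2 * y) x (+-cancelʳ-< q (w * (2 * y)) (w * x) (begin-strict
  w * (2 * y) + q ≡⟨ cong (_+ q) (*-rotate 2 w y) ⟨
  2 * w * y + q   ≡⟨ eq ⟨
  w * x + p       <⟨ +-monoʳ-< (w * x) p<q ⟩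
  w * x + q       ∎))
  where open ≤-Reasoning

transfer-> : ∀ w {x y p q} → w * x + p ≡ 2 * w * y + q → q < p → x < 2 * y
transfer-> w {x} {y} {p} {q} eq q<p = *-cancelˡ-< w x (2 * y) (+-cancelʳ-< p (w * x) (w * (2 * y)) (begin-strict
  w * x + p       ≡⟨ eq ⟩
  2 * w * y + q   <⟨ +-monoʳ-< (2 * w * y) q<p ⟩
  2 * w * y + p   ≡⟨ cong (_+ p) (*-rotate 2 w y) ⟩
  w * (2 * y) + p ∎))
  where open ≤-Reasoning

-- Transitivity of `x / y ≤ b / a ≤ s / r`, free of division.
ratio-≤ : ∀ a b r s {x y} .{{_ : NonZero a}} → a * x ≤ b * y → r * b ≤ s * a → r * x ≤ s * y
ratio-≤ a b r s {x} {y} ax≤by rb≤sa = *-cancelˡ-≤ a (begin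
  a * (r * x) ≡⟨ *-swap a r x ⟩
  r * (a * x) ≤⟨ *-monoʳ-≤ r ax≤by ⟩
  r * (b * y) ≡⟨ *-assoc r b y ⟨
  r * b * y   ≤⟨ *-monoˡ-≤ y rb≤sa ⟩
  s * a * y   ≡⟨ *-rotate s a y ⟩
  a * (s * y) ∎)
  where open ≤-Reasoning

ratio-< : ∀ a b r s {x y} → 0 < y → a * x ≤ b * y → r * b < s * a → r * x < s * y
ratio-< a b r s {x} {y@(suc _)} _ ax≤by rb<sa = *-cancelˡ-< a (r * x) (s * y) (begin-strict
  a * (r * x) ≡⟨ *-swap a r x ⟩
  r * (a * x) ≤⟨ *-monoʳ-≤ r ax≤by ⟩
  r * (b * y) ≡⟨ *-assoc r b y ⟨
  r * b * y   <⟨ *-monoˡ-< y rb<sa ⟩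
  s * a * y   ≡⟨ *-rotate s a y ⟩
  a * (s * y) ∎)
  where open ≤-Reasoning

-- Propagating the sign within one column.

module Column (m′ : ℕ) where

  m : ℕ
  m = suc m′

  -- The shift is chosen so that c w counts partitions with largest hook n = w + m.
  c : ℕ → ℕ
  c w = oddHeaded (w + m′) m

  -- This is `residual-zero` at `κ = w + m′`, where the leading factor `κ + 1 - μ` becomes `w`, with
  -- negative terms moved across to stay in ℕ.
  holonomic : ∀ w → w * c (3 + w) + (w + m) * c w ≡ 2 * w * c (2 + w) + 2 * m * c (1 + w)
  holonomic w = ℤ.+-injective (begin
    + (w * c (3 + w) + (w + m) * c w)
      ≡⟨ cong₂ _⊕_ (ℤ.pos-* w (c (3 + w))) (ℤ.pos-* (w + m) (c w)) ⟩
    + w ⊗ + c (3 + w) ⊕ (+ w ⊕ + m) ⊗ + c w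
      ≡⟨ lemma (+ w) (+ m′) (+ c w) (+ c (1 + w)) (+ c (2 + w)) (+ c (3 + w)) ⟩
    residualAt m (w + m′) ⊕ (+ 2 ⊗ + w ⊗ + c (2 + w) ⊕ + 2 ⊗ + m ⊗ + c (1 + w))
      ≡⟨ cong (_⊕ (+ 2 ⊗ + w ⊗ + c (2 + w) ⊕ + 2 ⊗ + m ⊗ + c (1 + w))) (residual-zero m (w + m′)) ⟩
    + 0 ⊕ (+ 2 ⊗ + w ⊗ + c (2 + w) ⊕ + 2 ⊗ + m ⊗ + c (1 + w))
      ≡⟨ ℤ.+-identityˡ _ ⟩
    + 2 ⊗ + w ⊗ + c (2 + w) ⊕ + 2 ⊗ + m ⊗ + c (1 + w)
      ≡⟨ cong₂ _⊕_ (pos-*₃ w (c (2 + w))) (pos-*₃ m (c (1 + w))) ⟨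
    + (2 * w * c (2 + w) + 2 * m * c (1 + w)) ∎)
    where
    open Int using (+_; _-_) renaming (_+_ to _⊕_; _*_ to _⊗_)
    open ≡-Reasoning
    pos-*₃ : ∀ x y → + (2 * x * y) ≡ + 2 ⊗ + x ⊗ + y
    pos-*₃ x y = trans (ℤ.pos-* (2 * x) y) (cong (_⊗ + y) (ℤ.pos-* 2 x))
    lemma : ∀ w m′ c₀ c₁ c₂ c₃ → w ⊗ c₃ ⊕ (w ⊕ (+ 1 ⊕ m′)) ⊗ c₀ ≡
      (w ⊕ m′ ⊕ + 1 - (+ 1 ⊕ m′)) ⊗ (c₃ - + 2 ⊗ c₂) ⊕ (w ⊕ m′ ⊕ + 1) ⊗ c₀ - + 2 ⊗ (+ 1 ⊕ m′) ⊗ c₁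
      ⊕ (+ 2 ⊗ w ⊗ c₂ ⊕ + 2 ⊗ (+ 1 ⊕ m′) ⊗ c₁)
    lemma = ℤRing.solve-∀

  4m≡2m*2 : ∀ x → 4 * m * x ≡ 2 * m * (2 * x)
  4m≡2m*2 x = lemma m x
    where
    lemma : ∀ m x → 4 * m * x ≡ 2 * m * (2 * x)
    lemma = solve-∀

  c≡0 : ∀ {w} → w ≤ 2 → c w ≡ 0
  c≡0 w≤2 = oddHeaded-zero (+-monoˡ-≤ m′ w≤2)

  c-positive : ∀ w → 0 < c (3 + w)
  c-positive zero    = ≤-trans (evenHeaded-positive m) (m≤n+m _ (c 2))
  c-positive (suc w) = m≤n⇒m≤n+o _ (c-positive w)

  Grows Declines : ℕ → Set
  Grows    v = 2 * c (2 + v) < c (3 + v)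
  Declines v = c (3 + v) < 2 * c (2 + v)

  -- As A n equals evenHeaded n, this reads A n (m − 1) − A n m = c (3 + v) − 2 c (2 + v).
  oddHeaded-evenHeaded : ∀ v → let n = suc (v + m′) in c (3 + v) + evenHeaded n m ≡ 2 * c (2 + v) + evenHeaded n m′
  oddHeaded-evenHeaded v = lemma (c (1 + v)) (evenHeaded (suc (v + m′)) m) (evenHeaded (suc (v + m′)) m′)
    where
    lemma : ∀ o e e′ → o + e + (e′ + o) + e ≡ 2 * (o + e) + e′
    lemma = solve-∀

  grows-if : ∀ w → (w + m) * c w < 2 * m * c (1 + w) → Grows w
  grows-if w = transfer-< w {c (3 + w)} {c (2 + w)} (holonomic w)

  declines-if : ∀ w → 2 * m * c (1 + w) < (w + m) * c w → Declines w
  declines-if w = transfer-> w {c (3 + w)} {c (2 + w)} (holonomic w)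

  grows-step : ∀ w → w + m ≤ 4 * m → 2 * c w < c (1 + w) → Grows w
  grows-step w w+m≤4m lt = grows-if w (begin-strict
    (w + m) * c w     ≤⟨ *-monoˡ-≤ (c w) w+m≤4m ⟩
    4 * m * c w       ≡⟨ 4m≡2m*2 (c w) ⟩
    2 * m * (2 * c w) <⟨ *-monoʳ-< (2 * m) lt ⟩
    2 * m * c (1 + w) ∎)
    where open ≤-Reasoning

  declines-step : ∀ w → 4 * m ≤ w + m → c (1 + w) < 2 * c w → Declines w
  declines-step w 4m≤w+m lt = declines-if w (begin-strict
    2 * m * c (1 + w) <⟨ *-monoʳ-< (2 * m) lt ⟩
    2 * m * (2 * c w) ≡⟨ 4m≡2m*2 (c w) ⟨
    4 * m * c w       ≤⟨ *-monoˡ-≤ (c w) 4m≤w+m ⟩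
    (w + m) * c w     ∎)
    where open ≤-Reasoning

  -- At `w = 1` the entries `c 1` and `c 2` vanish. The equality expresses the tie
  -- `A n (n - 2) = A n (n - 1)` at `n = m + 1`, just beyond the end of the sequence.
  c₄≡2c₃ : c 4 ≡ 2 * c 3
  c₄≡2c₃ = begin
    c 4                         ≡⟨ lemma (c 4) m ⟩
    1 * c 4 + (1 + m) * 0       ≡⟨ cong (λ x → 1 * c 4 + (1 + m) * x) (c≡0 {1} (s≤s z≤n)) ⟨
    1 * c 4 + (1 + m) * c 1     ≡⟨ holonomic 1 ⟩
    2 * 1 * c 3 + 2 * m * c 2   ≡⟨ cong (λ x → 2 * 1 * c 3 + 2 * m * x) (c≡0 {2} ≤-refl) ⟩
    2 * 1 * c 3 + 2 * m * 0     ≡⟨ lemma′ (c 3) m ⟩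
    2 * c 3                     ∎
    where
    open ≡-Reasoning
    lemma : ∀ x m → x ≡ 1 * x + (1 + m) * 0
    lemma = solve-∀
    lemma′ : ∀ x m → 2 * 1 * x + 2 * m * 0 ≡ 2 * x
    lemma′ = solve-∀

  grows-0 : Grows 0
  grows-0 = subst (λ x → 2 * x < c 3) (sym (c≡0 {2} ≤-refl)) (c-positive 0)

  module _ (2≤m : 2 ≤ m) where

    grows : ∀ v → v ≢ 1 → v + m ≤ 4 * m → Grows v
    grows zero                           _ _   = grows-0
    grows (suc zero)                     v≢1 _ = ⊥-elim (v≢1 refl)
    grows (suc (suc zero))               _ le  = grows-step 2 le grows-0
    -- The step of two would start from the tie at `v = 1`, so the tie itself is put into the
    -- criterion; `3 + m < 4 * m` is where `2 ≤ m` enters.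
    grows (suc (suc (suc zero)))         _ _   = grows-if 3 (begin-strict
      (3 + m) * c 3     <⟨ *-monoˡ-< (c 3) {{>-nonZero (c-positive 0)}} 3+m<4m ⟩
      4 * m * c 3       ≡⟨ 4m≡2m*2 (c 3) ⟩
      2 * m * (2 * c 3) ≡⟨ cong (2 * m *_) c₄≡2c₃ ⟨
      2 * m * c 4       ∎)
      where
      open ≤-Reasoning
      3+m<4m : 3 + m < 4 * m
      3+m<4m = begin
        4 + m     ≡⟨ +-comm 4 m ⟩
        m + 4     ≤⟨ +-monoʳ-≤ m (≤-trans (m≤m+n 4 2) (*-monoʳ-≤ 3 2≤m)) ⟩
        m + 3 * m ∎
    grows (suc (suc v@(suc (suc _))))    _ le  =
      grows-step (2 + v) le (grows v (λ ()) (≤-trans (m≤n+m (v + m) 2) le))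

    doubling : ∀ v → v + m ≤ 4 * m → 2 * c (2 + v) ≤ c (3 + v)
    doubling zero          le = <⇒≤ (grows 0 (λ ()) le)
    doubling (suc zero)    le = ≤-reflexive (sym c₄≡2c₃)
    doubling (suc (suc v)) le = <⇒≤ (grows (2 + v) (λ ()) le)

    -- An upper bound for consecutive ratios.

    -- By `holonomic` and the hypothesis, `suc w` times the excess of `c₃` over `2 c₂` is at most
    -- `(1 + d) c₁`, and `doubling` makes `c₁` at most half of `c₂`. The coefficient is then
    -- `4 * suc w + 1 + d`, rewritten using `suc w + d = 3 * m`.
    ratio-bound-step : ∀ w d → suc w + d ≡ 3 * m →
      2 * m * c (2 + w) ≤ (1 + d) * c (2 + w) + (suc w + m) * c (suc w) →
      2 * suc w * c (4 + w) ≤ (3 * m + 3 * suc w + 1) * c (3 + w)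
    ratio-bound-step w d w+d≡3m bound = begin
      2 * suc w * c₃                                ≡⟨ *-assoc 2 (suc w) c₃ ⟩
      2 * (suc w * c₃)                              ≤⟨ *-monoʳ-≤ 2 wc₃≤ ⟩
      2 * (2 * suc w * c₂ + (1 + d) * c₁)           ≡⟨ lemma (suc w) d c₂ c₁ ⟩
      4 * suc w * c₂ + (1 + d) * (2 * c₁)           ≤⟨ +-monoʳ-≤ (4 * suc w * c₂) (*-monoʳ-≤ (1 + d) (doubling w w+m≤4m)) ⟩
      4 * suc w * c₂ + (1 + d) * c₂                 ≡⟨ lemma′ (suc w) d c₂ ⟩
      (suc w + d + 3 * suc w + 1) * c₂              ≡⟨ cong (λ x → (x + 3 * suc w + 1) * c₂) w+d≡3m ⟩
      (3 * m + 3 * suc w + 1) * c₂                  ∎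
      where
      open ≤-Reasoning
      c₀ = c (1 + w)
      c₁ = c (2 + w)
      c₂ = c (3 + w)
      c₃ = c (4 + w)
      w+m≤4m : w + m ≤ 4 * m
      w+m≤4m = begin
        w + m         ≤⟨ +-monoˡ-≤ m (≤-trans (n≤1+n w) (m+n≤o⇒m≤o (suc w) (≤-reflexive w+d≡3m))) ⟩
        3 * m + m     ≡⟨ +-comm (3 * m) m ⟩
        4 * m         ∎
      wc₃≤ : suc w * c₃ ≤ 2 * suc w * c₂ + (1 + d) * c₁
      wc₃≤ = +-cancelʳ-≤ ((suc w + m) * c₀) _ _ (begin
        suc w * c₃ + (suc w + m) * c₀                                 ≡⟨ holonomic (suc w) ⟩
        2 * suc w * c₂ + 2 * m * c₁                                   ≤⟨ +-monoʳ-≤ (2 * suc w * c₂) bound ⟩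
        2 * suc w * c₂ + ((1 + d) * c₁ + (suc w + m) * c₀)            ≡⟨ +-assoc (2 * suc w * c₂) _ _ ⟨
        2 * suc w * c₂ + (1 + d) * c₁ + (suc w + m) * c₀              ∎)
      lemma : ∀ w d x y → 2 * (2 * w * x + (1 + d) * y) ≡ 4 * w * x + (1 + d) * (2 * y)
      lemma = solve-∀
      lemma′ : ∀ w d x → 4 * w * x + (1 + d) * x ≡ (w + d + 3 * w + 1) * x
      lemma′ = solve-∀

    -- Here `d` stands for `3 m - w`, so `w` stays in the range of `doubling`. At `w = 3 m` the
    -- bound on the ratio is `2 + 1 / (6 m)`, close enough to 2 for the start of the declining
    -- range.
    ratio-bound : ∀ w d → w + d ≡ 3 * m → 2 * w * c (3 + w) ≤ (3 * m + 3 * w + 1) * c (2 + w)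
    ratio-bound zero          d eq = z≤n
    ratio-bound (suc zero)    d eq = ratio-bound-step 0 d eq
      (≤-trans (*-monoˡ-≤ (c 2) (≤-trans (*-monoˡ-≤ m (m≤m+n 2 1)) (≤-reflexive (sym eq)))) (m≤m+n _ _))
    ratio-bound (suc (suc w)) d eq = ratio-bound-step (suc w) d eq bound
      where
      open ≤-Reasoning
      X = c (3 + w)
      Y = c (2 + w)
      -- For `w < m`, `2 * m ≤ 1 + d` suffices. Otherwise `2 * m` exceeds `1 + d` by `1 + e`, and
      -- the `Y` term absorbs the excess through the ratio bound two steps earlier.
      bound : 2 * m * X ≤ (1 + d) * X + (2 + w + m) * Y
      bound with m ≤? w
      ... | no m≰w = ≤-trans (*-monoˡ-≤ X (+-cancelˡ-≤ m _ _ (begin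
              m + 2 * m         ≡⟨ eq ⟨
              2 + w + d         ≤⟨ s≤s (+-monoˡ-≤ d (≰⇒> m≰w)) ⟩
              suc (m + d)       ≡⟨ +-suc m d ⟨
              m + (1 + d)       ∎))) (m≤m+n _ _)
      ... | yes m≤w = begin
              2 * m * X                        ≡⟨ cong (_* X) 2m≡ ⟩
              (1 + d + (1 + e)) * X            ≡⟨ *-distribʳ-+ X (1 + d) (1 + e) ⟩
              (1 + d) * X + (1 + e) * X        ≤⟨ +-monoʳ-≤ ((1 + d) * X) [1+e]X≤ ⟩
              (1 + d) * X + (2 + w + m) * Y    ∎
              where
              e = w ∸ m
              w≡m+e : w ≡ m + e
              w≡m+e = sym (m+[n∸m]≡n m≤w)
              shift : ∀ w d → w + (2 + d) ≡ 2 + w + d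
              shift = solve-∀
              2m≡ : 2 * m ≡ 1 + d + (1 + e)
              2m≡ = +-cancelˡ-≡ m _ _ (begin-equality
                m + 2 * m              ≡⟨ eq ⟨
                2 + w + d              ≡⟨ cong (λ x → 2 + x + d) w≡m+e ⟩
                2 + (m + e) + d        ≡⟨ lemma m e d ⟩
                m + (1 + d + (1 + e))  ∎)
                where
                lemma : ∀ m e d → 2 + (m + e) + d ≡ m + (1 + d + (1 + e))
                lemma = solve-∀
              rb≤sa : (1 + e) * (3 * m + 3 * w + 1) ≤ (2 + w + m) * (2 * w)
              rb≤sa = begin
                (1 + e) * (3 * m + 3 * w + 1)                   ≡⟨ cong (λ x → (1 + e) * (3 * m + 3 * x + 1)) w≡m+e ⟩
                (1 + e) * (3 * m + 3 * (m + e) + 1)             ≡⟨ lemma₁ m e ⟩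
                (1 + e) * (3 * (2 * m) + 3 * e + 1)             ≡⟨ cong (λ x → (1 + e) * (3 * x + 3 * e + 1)) 2m≡ ⟩
                -- Eliminating `m` leaves two polynomials in `d` and `e` whose difference, the term
                -- added here, has only nonnegative coefficients.
                (1 + e) * (3 * (1 + d + (1 + e)) + 3 * e + 1)   ≤⟨ m≤m+n _ (3 * e + 1 + 2 * e * d + 3 * d + d * d) ⟩
                (1 + e) * (3 * (1 + d + (1 + e)) + 3 * e + 1) + (3 * e + 1 + 2 * e * d + 3 * d + d * d)
                                                                ≡⟨ lemma₂ d e ⟩
                (2 + (1 + d + (1 + e)) + e) * ((1 + d + (1 + e)) + 2 * e)
                                                                ≡⟨ cong (λ x → (2 + x + e) * (x + 2 * e)) 2m≡ ⟨
                (2 + 2 * m + e) * (2 * m + 2 * e)               ≡⟨ lemma₃ m e ⟩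
                (2 + (m + e) + m) * (2 * (m + e))               ≡⟨ cong (λ x → (2 + x + m) * (2 * x)) w≡m+e ⟨
                (2 + w + m) * (2 * w)                           ∎
                where
                lemma₁ : ∀ m e → (1 + e) * (3 * m + 3 * (m + e) + 1) ≡ (1 + e) * (3 * (2 * m) + 3 * e + 1)
                lemma₁ = solve-∀
                lemma₂ : ∀ d e → (1 + e) * (3 * (1 + d + (1 + e)) + 3 * e + 1) + (3 * e + 1 + 2 * e * d + 3 * d + d * d)
                                 ≡ (2 + (1 + d + (1 + e)) + e) * ((1 + d + (1 + e)) + 2 * e)
                lemma₂ = solve-∀
                lemma₃ : ∀ m e → (2 + 2 * m + e) * (2 * m + 2 * e) ≡ (2 + (m + e) + m) * (2 * (m + e))
                lemma₃ = solve-∀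
              [1+e]X≤ : (1 + e) * X ≤ (2 + w + m) * Y
              [1+e]X≤ = ratio-≤ (2 * w) (3 * m + 3 * w + 1) (1 + e) (2 + w + m)
                {{m*n≢0 2 w {{_}} {{>-nonZero (≤-trans (s≤s z≤n) m≤w)}}}}
                (ratio-bound w (2 + d) (trans (shift w d) eq)) rb≤sa

  -- The sign moves in steps of two, so two consecutive starting values are required.
  declines-from : ∀ a → 3 * m ≤ suc a → Declines a → Declines (suc a) → ∀ j → Declines (j + a)
  declines-from a le d₀ d₁ zero          = d₀
  declines-from a le d₀ d₁ (suc zero)    = d₁
  declines-from a le d₀ d₁ (suc (suc j)) = declines-step (2 + (j + a)) (begin
      4 * m             ≡⟨ +-comm m (3 * m) ⟩
      3 * m + m         ≤⟨ +-monoˡ-≤ m (≤-trans le (s≤s (m≤n+m a (suc j)))) ⟩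
      2 + (j + a) + m   ∎)
    (declines-from a le d₀ d₁ j)
    where open ≤-Reasoning

-- The start of the declining range.

module _ (p : ℕ) where
  open Column (suc p)

  2≤m : 2 ≤ m
  2≤m = s≤s (s≤s z≤n)

  -- With `m = p + 2` this is `n = 4 m + 1`. The ratio bound at `3 m - 1` beats `n / (2 m)`; after
  -- cross-multiplication the margin is `2 m - 2`.
  declines-first : Declines (7 + 3 * p)
  declines-first = declines-if w
    (ratio-< (2 * (5 + 3 * p)) (3 * m + 3 * (5 + 3 * p) + 1) (2 * m) (w + m)
      {c (1 + w)} {c w}
      (c-positive (4 + 3 * p))
      (ratio-bound 2≤m (5 + 3 * p) 1 (lemma p))
      (≤-trans (m≤m+n _ (1 + 2 * p)) (≤-reflexive (lemma′ p))))
    where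
    w = 7 + 3 * p
    lemma : ∀ p → 5 + 3 * p + 1 ≡ 3 * (2 + p)
    lemma = solve-∀
    lemma′ : ∀ p → suc (2 * (2 + p) * (3 * (2 + p) + 3 * (5 + 3 * p) + 1)) + (1 + 2 * p)
                   ≡ (7 + 3 * p + (2 + p)) * (2 * (5 + 3 * p))
    lemma′ = solve-∀

  -- This is `n = 4 m + 2`, with the ratio bound taken at `3 m`; the margin is `10 m`.
  declines-second : Declines (8 + 3 * p)
  declines-second = declines-if w
    (ratio-< (2 * (6 + 3 * p)) (3 * m + 3 * (6 + 3 * p) + 1) (2 * m) (w + m)
      {c (1 + w)} {c w}
      (c-positive (5 + 3 * p))
      (ratio-bound 2≤m (6 + 3 * p) 0 (lemma p))
      (≤-trans (m≤m+n _ (19 + 10 * p)) (≤-reflexive (lemma′ p))))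
    where
    w = 8 + 3 * p
    lemma : ∀ p → 6 + 3 * p + 0 ≡ 3 * (2 + p)
    lemma = solve-∀
    lemma′ : ∀ p → suc (2 * (2 + p) * (3 * (2 + p) + 3 * (6 + 3 * p) + 1)) + (19 + 10 * p)
                   ≡ (8 + 3 * p + (2 + p)) * (2 * (6 + 3 * p))
    lemma′ = solve-∀

open Column using (Declines)

declines : ∀ p j → Declines (suc p) (j + (7 + 3 * p))
declines p = Column.declines-from (suc p) (7 + 3 * p) (≤-trans (≤-reflexive (lemma p)) (m≤n+m _ 2)) (declines-first p) (declines-second p)
  where
  lemma : ∀ p → 3 * (2 + p) ≡ 6 + 3 * p
  lemma = solve-∀

-- For `m = 1` the value `n = 5` is a tie, `c 7 = 2 * c 6 = 20`, so the decline starts at `n = 6`.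
-- The starting inequalities are `38 < 40` and `71 < 76`, by evaluation.
declines-1 : ∀ j → Declines 0 (j + 5)
declines-1 = Column.declines-from 0 5 (m≤m+n 3 3) (m≤m+n 39 1) (m≤m+n 72 4)

-- Unimodality of the rows of `A`.

-- With `m = i + 1` and `n = k + 1`, the condition is `n ≥ 4 m + 1`, the range where `c` less than
-- doubles.
A-increases : ∀ k i → 5 ≤ k → 4 * suc i ≤ k → A (suc k) i < A (suc k) (suc i)
A-increases k i 5≤k 4m≤k = subst₂ _<_ (sym (A≡evenHeaded k i)) (sym (A≡evenHeaded k (suc i))) (subst
  (λ x → evenHeaded (suc x) i < evenHeaded (suc x) (suc i)) (m∸n+n≡m i≤k)
  (+-cancelˡ-< (2 * c (2 + v)) _ _ (begin-strict
    2 * c (2 + v) + evenHeaded n i       ≡⟨ oddHeaded-evenHeaded v ⟨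
    c (3 + v) + evenHeaded n (suc i)     <⟨ +-monoˡ-< (evenHeaded n (suc i)) (late i v≥ 5≤k) ⟩
    2 * c (2 + v) + evenHeaded n (suc i) ∎)))
  where
  open ≤-Reasoning
  open Column i
  v = k ∸ i
  n = suc (v + i)
  i≤k : i ≤ k
  i≤k = ≤-trans (≤-trans (n≤1+n i) (m≤n*m (suc i) 4)) 4m≤k
  v≥ : 4 + 3 * i ≤ v
  v≥ = m+n≤o⇒m≤o∸n (4 + 3 * i) (≤-trans (≤-reflexive (lemma i)) 4m≤k)
    where
    lemma : ∀ i → 4 + 3 * i + i ≡ 4 * suc i
    lemma = solve-∀
  -- For `m = 1`, `5 ≤ k` places `n` beyond the tie at `n = 5`.
  late : ∀ i → 4 + 3 * i ≤ k ∸ i → 5 ≤ k → Column.Declines i (k ∸ i)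
  late zero    _  5≤k = subst (Column.Declines 0) (m∸n+n≡m 5≤k) (declines-1 (k ∸ 5))
  late (suc p) le _   = subst (Column.Declines (suc p)) (m∸n+n≡m le′) (declines p (k ∸ suc p ∸ (7 + 3 * p)))
    where
    lemma : ∀ p → 7 + 3 * p ≡ 4 + 3 * suc p
    lemma = solve-∀
    le′ : 7 + 3 * p ≤ k ∸ suc p
    le′ = ≤-trans (≤-reflexive (lemma p)) le

-- Now `n ≤ 4 m` with `m = i + 1 ≥ 2`, and `2 + i ≤ k` keeps clear of the tie at `v = 1`.
A-decreases : ∀ k i → 1 ≤ i → 2 + i ≤ k → k < 4 * suc i → A (suc k) (suc i) < A (suc k) i
A-decreases k i 1≤i 2+i≤k k<4m = subst₂ _<_ (sym (A≡evenHeaded k (suc i))) (sym (A≡evenHeaded k i)) (subst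
  (λ x → evenHeaded (suc x) (suc i) < evenHeaded (suc x) i) v+i≡k
  (+-cancelˡ-< (2 * c (2 + v)) _ _ (begin-strict
    2 * c (2 + v) + evenHeaded n (suc i) <⟨ +-monoˡ-< (evenHeaded n (suc i)) (grows (s≤s 1≤i) v v≢1 v+m≤4m) ⟩
    c (3 + v) + evenHeaded n (suc i)     ≡⟨ oddHeaded-evenHeaded v ⟩
    2 * c (2 + v) + evenHeaded n i       ∎)))
  where
  open ≤-Reasoning
  open Column i
  v = k ∸ i
  n = suc (v + i)
  v+i≡k : v + i ≡ k
  v+i≡k = m∸n+n≡m (≤-trans (m≤n+m i 2) 2+i≤k)
  v≢1 : v ≢ 1
  v≢1 v≡1 = 1+n≰n (≤-trans (m+n≤o⇒m≤o∸n 2 2+i≤k) (≤-reflexive v≡1))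
  v+m≤4m : v + suc i ≤ 4 * suc i
  v+m≤4m = ≤-trans (≤-reflexive (trans (+-suc v i) (cong suc v+i≡k))) k<4m

theorem1p1 : (n : ℕ) → 6 ≤ n → StronglyUnimodal (A n) (n ∸ 2) ((n ∸ 1) / 4)
theorem1p1 (suc k@(suc l)) (s≤s 5≤k) = stronglyUnimodal
  (s≤s⁻¹ (m/n<m k 4 (s≤s (s≤s z≤n))))
  (λ i i<k/4 → A-increases k i 5≤k (≤-trans (≤-trans (*-monoʳ-≤ 4 i<k/4) (≤-reflexive (*-comm 4 (k / 4)))) (m/n*n≤m k 4)))
  -- `k ≥ 5` gives `k / 4 ≥ 1`, hence `i ≥ 1`; the remainder being below 4 gives `k < 4 * suc i`.
  (λ i k/4≤i i<l → A-decreases k i (≤-trans (/-monoˡ-≤ 4 (≤-trans (n≤1+n 4) 5≤k)) k/4≤i) (s≤s i<l)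
    (begin-strict
      k                       ≡⟨ m≡m%n+[m/n]*n k 4 ⟩
      k % 4 + k / 4 * 4       <⟨ +-mono-<-≤ (m%n<n k 4) (*-monoˡ-≤ 4 k/4≤i) ⟩
      4 + i * 4               ≡⟨ *-comm (suc i) 4 ⟩
      4 * suc i               ∎))
  where open ≤-Reasoning
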